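{- For any positive integer $k$ there exists a positive integer $d(k)$ such that the following holds: if $T$ is a tournament with minimum out-degree $\delta^+(T) \ge d(k)$, then $T$ contains a subdivision of $\overrightarrow{K}_k$.
   Context: A tournament is a (finite) directed graph in which, for every pair of distinct vertices $x,y$, exactly one of the directed edges $xy$, $yx$ is present. The complete directed graph $\overrightarrow{K}_k$ is the directed graph on $k$ vertices in which, for every pair $x,y$ of distinct vertices, both directed edges $xy$ and $yx$ are present. A subdivision of $\overrightarrow{K}_k$ in $T$ consists of a set $U$ of $k$ distinct vertices of $T$ (branch vertices) together with, for each ordered pair $(u,v)$ of distinct vertices of $U$, a directed path $P_{uv}$ in $T$ from $u$ to $v$ (of length at least $1$), such that the interior vertices of each path are not in $U$ and no interior vertex of one of these paths lies on another of these paths. $\delta^+(T)$ denotes the minimum out-degree of $T$. -}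

module Defs where

open import Level using (0ℓ)
open import Data.Nat.Base using (ℕ; suc; _⊓_)
open import Data.Fin.Base using (Fin)
open import Data.Fin.Properties using (_≟_)
open import Data.List.Base using (List; []; _∷_; _++_)
open import Data.List.Membership.Propositional using (_∈_; _∉_)
open import Data.List.Relation.Unary.Linked using (Linked)
open import Data.List.Relation.Unary.Unique.Propositional using (Unique)
open import Data.Product.Base using (_×_; _,_)
open import Data.Sum.Base using (_⊎_)
open import Data.Vec.Base using (allFin; count; foldr₁; tabulate)
open import Function.Definitions using (Injective)
open import Relation.Binary.Core using (Rel)
open import Relation.Binary.Definitions using (Decidable; Irreflexive)
open import Relation.Binary.PropositionalEquality using (_≡_; _≢_)
open import Relation.Nullary using (¬_; ¬?)

-- Finite directed graphs with vertex set Fin n, without loops or parallel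
-- edges.  Adjacency is decidable, so that out-degrees can be counted.
record Digraph (n : ℕ) : Set₁ where
  field
    Edge      : Rel (Fin n) 0ℓ
    edge?     : Decidable Edge
    loop-free : Irreflexive _≡_ Edge

open Digraph public

IsTournament : ∀ {n} → Digraph n → Set
IsTournament G = ∀ x y → x ≢ y →
  (Edge G x y × ¬ Edge G y x) ⊎ (¬ Edge G x y × Edge G y x)

outDegree : ∀ {n} → Digraph n → Fin n → ℕ
outDegree {n} G x = count (edge? G x) (allFin n)

-- The minimum is only meaningful for a nonempty vertex set, hence suc n.
δ⁺ : ∀ {n} → Digraph (suc n) → ℕ
δ⁺ G = foldr₁ _⊓_ (tabulate (outDegree G))

completeDigraph : ∀ k → Digraph k
completeDigraph k = record
  { Edge      = _≢_
  ; edge?     = λ i j → ¬? (i ≟ j)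
  ; loop-free = λ i≡j i≢j → i≢j i≡j
  }

-- Directed paths from u to v, of length at least 1: the endpoints are
-- separate entries of the vertex sequence.
record Path {n : ℕ} (G : Digraph n) (u v : Fin n) : Set where
  field
    interior : List (Fin n)

  vertices : List (Fin n)
  vertices = u ∷ interior ++ v ∷ []

  field
    linked : Linked (Edge G) vertices
    unique : Unique vertices

open Path public

-- A subdivision of H in G.  The set of branch vertices is the image of the
-- injection branch; for complete H there is one path for each ordered pair of
-- distinct branch vertices.
record Subdivision {k n : ℕ} (H : Digraph k) (G : Digraph n) : Set where
  field
    branch           : Fin k → Fin n
    branch-injective : Injective _≡_ _≡_ branch
    path             : ∀ {i j} → Edge H i j → Path G (branch i) (branch j)
    avoids-branch    : ∀ {i j} (e : Edge H i j) {x} →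
                       x ∈ interior (path e) → ∀ l → x ≢ branch l
    disjoint         : ∀ {i j i′ j′} (e : Edge H i j) (e′ : Edge H i′ j′) →
                       (i , j) ≢ (i′ , j′) → ∀ {x} →
                       x ∈ interior (path e) → x ∉ vertices (path e′)

-- Let the branch vertices be the k vertices of largest in-degree.  The paths
-- between them are chosen greedily, each with at most two interior vertices.
-- To join u to v while avoiding a set C of at most c vertices that contains
-- the branch vertices, put A = N⁻(v) ∖ C and B = N⁺(u) ∖ C.  If A meets B or
-- there is an edge from B to A, we are done.  Otherwise every vertex of A
-- dominates every vertex of B.  When d is large, some b in B has more than c
-- in-neighbours within B, hence more than |A| + c ≥ |N⁻(v)| in-neighbours
-- altogether, contradicting the choice of the branch vertices.

module Submission where

open import Defs hiding (unique)
open import Data.Bool.Base using (true; false)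
open import Data.Fin.Base using (Fin; zero; suc; combine; remQuot)
open import Data.Fin.Properties
  using (_≟_; remQuot-combine; combine-injective; injective⇒≤)
open import Data.List.Base as List
  using (List; []; _∷_; _++_; length; filter; lookup; allFin)
open import Data.List.Extrema.Nat
  using (argmax; argmax-sel; f[xs]≤f[argmax]; f[⊥]≤f[argmax])
open import Data.List.Membership.Propositional using (_∈_; _∉_; find; lose)
open import Data.List.Membership.Propositional.Properties
  using (∈-lookup; ∈-filter⁺; ∈-filter⁻; ∈-allFin; ∈-++⁺ˡ; ∈-++⁺ʳ; ∈-++⁻)
open import Data.List.Membership.Setoid.Properties using (index-injective)
open import Data.List.Properties using (length-++; length-filter; length-tabulate)
open import Data.List.Relation.Binary.Disjoint.Propositional using (Disjoint)
open import Data.List.Relation.Binary.Subset.Propositional using (_⊆_)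
open import Data.List.Relation.Unary.All as All using ([]; _∷_)
open import Data.List.Relation.Unary.AllPairs using ([]; _∷_)
open import Data.List.Relation.Unary.Any using (here; there; any?)
open import Data.List.Relation.Unary.Linked using (Linked; [-]; _∷_)
open import Data.List.Relation.Unary.Unique.Propositional using (Unique)
open import Data.List.Relation.Unary.Unique.Propositional.Properties as Unique
  using (allFin⁺; filter⁺; Unique[x∷xs]⇒x∉xs)
open import Data.Nat.Base
  using (ℕ; zero; suc; _+_; _*_; _^_; _⊓_; _≤_; _<_; _≥_; z≤n; s≤s)
open import Data.Nat.Properties hiding (_≟_)
open import Data.Product.Base using (∃-syntax; Σ-syntax; _×_; _,_; proj₁; proj₂; uncurry)
open import Data.Sum.Base using (inj₁; inj₂; [_,_]′)
open import Data.Vec.Base as Vec using (count; foldr₁)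
open import Function.Base using (_∘_; id)
open import Function.Definitions using (Injective)
open import Relation.Binary.PropositionalEquality
  using (_≡_; _≢_; refl; sym; cong; subst; setoid; ≢-sym)
open import Relation.Nullary using (¬_; ¬?; yes; no; contradiction; does)
open import Relation.Unary using (Decidable)

-- Lists without repetition, counts and minima

lookup-injective : ∀ {A : Set} {xs : List A} → Unique xs → Injective _≡_ _≡_ (lookup xs)
lookup-injective {xs = x ∷ xs} u       {zero}  {zero}  eq = refl
lookup-injective {xs = x ∷ xs} u       {zero}  {suc j} eq =
  contradiction (subst (_∈ xs) (sym eq) (∈-lookup j)) (Unique[x∷xs]⇒x∉xs u)
lookup-injective {xs = x ∷ xs} u       {suc i} {zero}  eq =
  contradiction (subst (_∈ xs) eq (∈-lookup i)) (Unique[x∷xs]⇒x∉xs u)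
lookup-injective {xs = x ∷ xs} (_ ∷ u) {suc i} {suc j} eq = cong suc (lookup-injective u eq)

-- Sending a position in `xs` to a position of the same entry in `ys` is injective, because `xs` has
-- no repetitions.
Unique-⊆⇒length≤ : ∀ {A : Set} {xs ys : List A} → Unique xs → xs ⊆ ys → length xs ≤ length ys
Unique-⊆⇒length≤ u xs⊆ys = injective⇒≤ λ eq →
  lookup-injective u (index-injective (setoid _) (xs⊆ys (∈-lookup _)) (xs⊆ys (∈-lookup _)) eq)

Unique-⊆++⇒length≤ : ∀ {A : Set} {xs : List A} ys {zs} → Unique xs → xs ⊆ ys ++ zs →
                     length xs ≤ length ys + length zs
Unique-⊆++⇒length≤ ys u sub = ≤-trans (Unique-⊆⇒length≤ u sub) (≤-reflexive (length-++ ys))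

-- Links `outDegree`, a count over a vector, to the length of the list `N⁺`.
count-tabulate : ∀ {A : Set} {P : A → Set} (P? : Decidable P) {n} (f : Fin n → A) →
                 count P? (Vec.tabulate f) ≡ length (filter P? (List.tabulate f))
count-tabulate P? {zero}  f = refl
count-tabulate P? {suc n} f with does (P? (f zero))
... | true  = cong suc (count-tabulate P? (f ∘ suc))
... | false = count-tabulate P? (f ∘ suc)

foldr₁-⊓-≤ : ∀ {n} (f : Fin (suc n) → ℕ) i → foldr₁ _⊓_ (Vec.tabulate f) ≤ f i
foldr₁-⊓-≤ {zero}  f zero    = ≤-refl
foldr₁-⊓-≤ {suc n} f zero    = m⊓n≤m _ _
foldr₁-⊓-≤ {suc n} f (suc i) = ≤-trans (m⊓n≤n (f zero) _) (foldr₁-⊓-≤ (f ∘ suc) i)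

n<2^n : ∀ n → n < 2 ^ n
n<2^n zero    = ≤-refl
n<2^n (suc n) = begin-strict
  suc n               <⟨ +-mono-≤-< (m^n>0 2 n) (n<2^n n) ⟩
  2 ^ n + 2 ^ n       ≡⟨ cong (2 ^ n +_) (sym (+-identityʳ (2 ^ n))) ⟩
  2 ^ suc n           ∎
  where open ≤-Reasoning

-- Set difference and the elements with the largest values

module _ {n : ℕ} where

  open import Data.List.Membership.DecPropositional (_≟_ {n}) using (_∈?_)

  infixl 6 _∖_
  _∖_ : List (Fin n) → List (Fin n) → List (Fin n)
  xs ∖ C = filter (λ x → ¬? (x ∈? C)) xs

  ∈-∖⁻ : ∀ {x} xs C → x ∈ xs ∖ C → x ∈ xs × x ∉ C
  ∈-∖⁻ xs C = ∈-filter⁻ (λ x → ¬? (x ∈? C))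

  ⊆-∖-++ : ∀ xs C → xs ⊆ (xs ∖ C) ++ C
  ⊆-∖-++ xs C {x} x∈xs with x ∈? C
  ... | yes x∈C = ∈-++⁺ʳ (xs ∖ C) x∈C
  ... | no  x∉C = ∈-++⁺ˡ (∈-filter⁺ (λ x → ¬? (x ∈? C)) x∈xs x∉C)

  length-∖ : ∀ {xs} C → Unique xs → length xs ≤ length (xs ∖ C) + length C
  length-∖ {xs} C u = Unique-⊆++⇒length≤ (xs ∖ C) u (⊆-∖-++ xs C)

  -- Induction on `k`: a maximiser of `f` outside the set found so far is added to it. With `f` the
  -- in-degree this yields the branch vertices.
  topElements : (f : Fin n → ℕ) → ∀ k → k ≤ n →
    ∃[ S ] (Unique S × length S ≡ k × (∀ {x y} → x ∉ S → y ∈ S → f x ≤ f y))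
  topElements f zero    _   = [] , [] , refl , λ _ ()
  topElements f (suc k) k<n with topElements f k (<⇒≤ k<n)
  ... | S , uS , refl , top = extend (allFin n ∖ S) refl
    where
    -- `argmax` needs a default element, so the remainder is matched through an equation and its
    -- head serves as the default.
    extend : ∀ R → allFin n ∖ S ≡ R →
             ∃[ S′ ] (Unique S′ × length S′ ≡ suc k × (∀ {x y} → x ∉ S′ → y ∈ S′ → f x ≤ f y))
    -- An empty remainder would mean that `S` covers all `n` elements, although it has only `k < n`.
    extend [] eq = contradiction k<n (≤⇒≯ (subst (_≤ length S) (length-tabulate {n = n} id)
      (subst (λ R → length (allFin n) ≤ length R + length S) eq (length-∖ S (allFin⁺ n)))))
    extend (r ∷ rs) eq = m ∷ S , All.tabulate (λ y∈S m≡y → m∉S (subst (_∈ S) (sym m≡y) y∈S)) ∷ uS ,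
      refl , top′
      where
      m = argmax f r rs

      m∈R : m ∈ r ∷ rs
      m∈R = [ here , there ]′ (argmax-sel f r rs)

      m∉S : m ∉ S
      m∉S = proj₂ (∈-∖⁻ (allFin n) S (subst (m ∈_) (sym eq) m∈R))

      ≤m : ∀ {x} → x ∈ r ∷ rs → f x ≤ f m
      ≤m (here refl)  = f[⊥]≤f[argmax] {f = f} r rs
      ≤m (there x∈rs) = All.lookup (f[xs]≤f[argmax] {f = f} r rs) x∈rs

      top′ : ∀ {x y} → x ∉ m ∷ S → y ∈ m ∷ S → f x ≤ f y
      top′ x∉ (there y∈S) = top (x∉ ∘ there) y∈S
      top′ x∉ (here refl) =
        ≤m (subst (_ ∈_) eq (∈-filter⁺ (λ x → ¬? (x ∈? S)) (∈-allFin _) (x∉ ∘ there)))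

-- Greedy choice of disjoint lists

-- Each chosen list joins the forbidden list `C` and lengthens it by at most `ℓ`, so `m` choices
-- stay within the fixed bound `N`.
chooseDisjoint : ∀ {A : Set} {ℓ N} m (Good : Fin m → List A → Set) →
  (∀ i C → length C ≤ N → ∃[ xs ] (length xs ≤ ℓ × Disjoint xs C × Good i xs)) →
  ∀ C → m * ℓ + length C ≤ N →
  Σ[ f ∈ (Fin m → List A) ] ((∀ i → Good i (f i)) × (∀ i → Disjoint (f i) C) × (∀ {i j} → i ≢ j → Disjoint (f i) (f j)))
chooseDisjoint zero Good choose C _ = (λ ()) , (λ ()) , (λ ()) , λ { {()} }
chooseDisjoint {A} {ℓ} {N} (suc m) Good choose C bound
  with choose zero C (m+n≤o⇒n≤o (suc m * ℓ) bound)
... | xs , xs≤ℓ , xs#C , good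
  with chooseDisjoint m (Good ∘ suc) (choose ∘ suc) (xs ++ C) bound′
  where
  open ≤-Reasoning
  bound′ : m * ℓ + length (xs ++ C) ≤ N
  bound′ = begin
    m * ℓ + length (xs ++ C)         ≡⟨ cong (m * ℓ +_) (length-++ xs) ⟩
    m * ℓ + (length xs + length C)   ≡⟨ sym (+-assoc (m * ℓ) (length xs) (length C)) ⟩
    m * ℓ + length xs + length C     ≤⟨ +-monoˡ-≤ (length C) (+-monoʳ-≤ (m * ℓ) xs≤ℓ) ⟩
    m * ℓ + ℓ + length C             ≡⟨ cong (_+ length C) (+-comm (m * ℓ) ℓ) ⟩
    suc m * ℓ + length C             ≤⟨ bound ⟩
    N                                ∎
... | f , goods , f#xsC , f#f = g , good′ , g#C , g#g
  where
  g : Fin (suc m) → List A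
  g zero    = xs
  g (suc i) = f i

  good′ : ∀ i → Good i (g i)
  good′ zero    = good
  good′ (suc i) = goods i

  g#C : ∀ i → Disjoint (g i) C
  g#C zero            = xs#C
  g#C (suc i) (p , q) = f#xsC i (p , ∈-++⁺ʳ xs q)

  g#g : ∀ {i j} → i ≢ j → Disjoint (g i) (g j)
  g#g {zero}  {zero}  i≢j         = contradiction refl i≢j
  g#g {zero}  {suc j} i≢j (p , q) = f#xsC j (q , ∈-++⁺ˡ p)
  g#g {suc i} {zero}  i≢j (p , q) = f#xsC i (p , ∈-++⁺ˡ q)
  g#g {suc i} {suc j} i≢j         = f#f (i≢j ∘ cong suc)

-- Short paths in tournaments

module _ {n : ℕ} (T : Digraph n) where

  open import Data.List.Membership.DecPropositional (_≟_ {n}) using (_∈?_)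

  N⁺ N⁻ : Fin n → List (Fin n)
  N⁺ u = filter (edge? T u) (allFin n)
  N⁻ v = filter (λ w → edge? T w v) (allFin n)

  -- The two conditions of `Path` as a predicate on the interior, so that the lists can be chosen
  -- before the paths are formed.
  IsInterior : List (Fin n) → Fin n → Fin n → Set
  IsInterior xs u v = Linked (Edge T) (u ∷ xs ++ v ∷ []) × Unique (u ∷ xs ++ v ∷ [])

  module _ (tournament : IsTournament T) where

    reverseEdge : ∀ {x y} → x ≢ y → ¬ Edge T x y → Edge T y x
    reverseEdge x≢y ¬xy = [ (λ p → contradiction (proj₁ p) ¬xy) , proj₂ ]′ (tournament _ _ x≢y)

    -- Induction on `m`. If the first vertex `x` has at least `2 ^ m` out-neighbours in the list, a
    -- vertex `b` found among them gains `x` as one more in-neighbour. Otherwise `x` itself has at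
    -- least `2 ^ m > m` in-neighbours. Averaging would give a linear bound, but this argument needs
    -- no double counting.
    largeInDegreeWithin : ∀ m xs → Unique xs → 2 ^ m ≤ length xs →
      ∃[ b ] (b ∈ xs × m ≤ length (filter (λ w → edge? T w b) xs))
    largeInDegreeWithin zero    (x ∷ xs) _ _ = x , here refl , z≤n
    largeInDegreeWithin (suc m) []       _ p = contradiction p (<⇒≱ (m^n>0 2 (suc m)))
    largeInDegreeWithin (suc m) (x ∷ xs) (x∉xs ∷ uxs) 2^m≤ with 2 ^ m ≤? length (filter (edge? T x) xs)
    ... | yes large with largeInDegreeWithin m (filter (edge? T x) xs) (filter⁺ (edge? T x) uxs) large
    ...   | b , b∈out , m≤ = b , there (proj₁ b∈) , ≤-trans (s≤s m≤) (Unique-⊆⇒length≤ unique sub)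
      where
      b∈ = ∈-filter⁻ (edge? T x) {xs = xs} b∈out
      inOut = filter (λ w → edge? T w b) (filter (edge? T x) xs)

      inOut⁻ : ∀ {y} → y ∈ inOut → y ∈ xs × Edge T y b
      inOut⁻ y∈ with y∈out , yb ← ∈-filter⁻ (λ w → edge? T w b) {xs = filter (edge? T x) xs} y∈
        = proj₁ (∈-filter⁻ (edge? T x) y∈out) , yb

      unique : Unique (x ∷ inOut)
      unique = All.tabulate (λ y∈ → All.lookup x∉xs (proj₁ (inOut⁻ y∈)))
             ∷ filter⁺ (λ w → edge? T w b) (filter⁺ (edge? T x) uxs)

      sub : x ∷ inOut ⊆ filter (λ w → edge? T w b) (x ∷ xs)
      sub (here refl) = ∈-filter⁺ (λ w → edge? T w b) (here refl) (proj₂ b∈)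
      sub (there y∈)  = ∈-filter⁺ (λ w → edge? T w b) (there (proj₁ (inOut⁻ y∈))) (proj₂ (inOut⁻ y∈))
    largeInDegreeWithin (suc m) (x ∷ xs) (x∉xs ∷ uxs) 2^m≤ | no small =
      x , here refl , ≤-trans (n<2^n m) (≤-trans 2^m≤in
        (Unique-⊆⇒length≤ (filter⁺ (λ w → edge? T w x) uxs) sub))
      where
      open ≤-Reasoning
      ins outs : List (Fin n)
      ins  = filter (λ w → edge? T w x) xs
      outs = filter (edge? T x) xs

      split : xs ⊆ ins ++ outs
      split {y} y∈ with edge? T x y
      ... | yes xy = ∈-++⁺ʳ ins (∈-filter⁺ (edge? T x) y∈ xy)
      ... | no ¬xy = ∈-++⁺ˡ (∈-filter⁺ (λ w → edge? T w x) y∈ (reverseEdge (All.lookup x∉xs y∈) ¬xy))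

      2^m≤in : 2 ^ m ≤ length ins
      -- The length of the whole list counts `x` too; the strict inequality `length outs < 2 ^ m`
      -- absorbs this extra one.
      2^m≤in = +-cancelʳ-≤ (2 ^ m) (2 ^ m) (length ins) (begin
        2 ^ m + 2 ^ m                    ≡⟨ cong (2 ^ m +_) (sym (+-identityʳ (2 ^ m))) ⟩
        2 ^ suc m                        ≤⟨ 2^m≤ ⟩
        suc (length xs)                  ≤⟨ s≤s (Unique-⊆++⇒length≤ ins uxs split) ⟩
        suc (length ins + length outs)   ≡⟨ sym (+-suc (length ins) (length outs)) ⟩
        length ins + suc (length outs)   ≤⟨ +-monoʳ-≤ (length ins) (≰⇒> small) ⟩
        length ins + 2 ^ m               ∎)

      sub : ins ⊆ filter (λ w → edge? T w x) (x ∷ xs)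
      sub y∈ with y∈xs , yx ← ∈-filter⁻ (λ w → edge? T w x) {xs = xs} y∈ =
        ∈-filter⁺ (λ w → edge? T w x) (there y∈xs) yx

    -- In the degree bound, the summand `c` pays for deleting `C` from `N⁺ u`, and `2 ^ suc c`
    -- provides a vertex with more than `c` in-neighbours in what remains.
    shortPathAvoiding : ∀ {c u v} C → length C ≤ c → u ∈ C → v ∈ C → u ≢ v →
      (∀ {b} → b ∉ C → length (N⁻ b) ≤ length (N⁻ v)) →
      2 ^ suc c + c ≤ length (N⁺ u) →
      ∃[ xs ] (length xs ≤ 2 × Disjoint xs C × IsInterior xs u v)
    shortPathAvoiding {c} {u} {v} C C≤c u∈C v∈C u≢v maximal large = cases
      where
      open ≤-Reasoning

      A B : List (Fin n)
      A = N⁻ v ∖ C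
      B = N⁺ u ∖ C

      A⁻ : ∀ {a} → a ∈ A → Edge T a v × a ∉ C
      A⁻ a∈ with a∈N , a∉C ← ∈-∖⁻ (N⁻ v) C a∈ =
        proj₂ (∈-filter⁻ (λ w → edge? T w v) {xs = allFin n} a∈N) , a∉C

      B⁻ : ∀ {b} → b ∈ B → Edge T u b × b ∉ C
      B⁻ b∈ with b∈N , b∉C ← ∈-∖⁻ (N⁺ u) C b∈ =
        proj₂ (∈-filter⁻ (edge? T u) {xs = allFin n} b∈N) , b∉C

      uniqueA : Unique A
      uniqueA = filter⁺ _ (filter⁺ (λ w → edge? T w v) (allFin⁺ n))

      uniqueB : Unique B
      uniqueB = filter⁺ _ (filter⁺ (edge? T u) (allFin⁺ n))

      ∈C⇒≢ : ∀ {x y} → x ∈ C → y ∉ C → x ≢ y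
      ∈C⇒≢ x∈C y∉C refl = y∉C x∈C

      2^≤B : 2 ^ suc c ≤ length B
      2^≤B = +-cancelʳ-≤ c (2 ^ suc c) (length B) (begin
        2 ^ suc c + c          ≤⟨ large ⟩
        length (N⁺ u)          ≤⟨ length-∖ C (filter⁺ (edge? T u) (allFin⁺ n)) ⟩
        length B + length C    ≤⟨ +-monoʳ-≤ (length B) C≤c ⟩
        length B + c           ∎)

      notDominating : Disjoint A B → ¬ (∀ {a b} → a ∈ A → b ∈ B → Edge T a b)
      -- `A` and `inB` are disjoint sets of in-neighbours of `b`, so their sizes add up; `b` lies
      -- outside `C`, so `maximal` applies to it.
      notDominating A#B A⇒B with largeInDegreeWithin (suc c) B uniqueB 2^≤B
      ... | b , b∈B , c< = <-irrefl refl (begin-strict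
        length A + c                   <⟨ +-monoʳ-< (length A) c< ⟩
        length A + length inB          ≡⟨ sym (length-++ A) ⟩
        length (A ++ inB)              ≤⟨ Unique-⊆⇒length≤ unique sub ⟩
        length (N⁻ b)                  ≤⟨ maximal (proj₂ (B⁻ b∈B)) ⟩
        length (N⁻ v)                  ≤⟨ length-∖ C (filter⁺ (λ w → edge? T w v) (allFin⁺ n)) ⟩
        length A + length C            ≤⟨ +-monoʳ-≤ (length A) C≤c ⟩
        length A + c                   ∎)
        where
        inB = filter (λ w → edge? T w b) B

        inB⁻ : ∀ {y} → y ∈ inB → y ∈ B × Edge T y b
        inB⁻ = ∈-filter⁻ (λ w → edge? T w b)

        unique : Unique (A ++ inB)
        unique = Unique.++⁺ uniqueA (filter⁺ (λ w → edge? T w b) uniqueB)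
                   (λ (y∈A , y∈inB) → A#B (y∈A , proj₁ (inB⁻ y∈inB)))

        sub : A ++ inB ⊆ N⁻ b
        sub y∈ = ∈-filter⁺ (λ w → edge? T w b) (∈-allFin _)
                   ([ (λ y∈A → A⇒B y∈A b∈B) , proj₂ ∘ inB⁻ ]′ (∈-++⁻ A y∈))

      cases : ∃[ xs ] (length xs ≤ 2 × Disjoint xs C × IsInterior xs u v)
      cases with any? (_∈? B) A
      ... | yes meet with w , w∈A , w∈B ← find meet
                     with wv , w∉C ← A⁻ w∈A | uw , _ ← B⁻ w∈B =
        w ∷ [] , s≤s z≤n ,
        (λ { (here refl , w∈C) → w∉C w∈C }) ,
        uw ∷ wv ∷ [-] ,
        (∈C⇒≢ u∈C w∉C ∷ u≢v ∷ []) ∷ (≢-sym (∈C⇒≢ v∈C w∉C) ∷ []) ∷ [] ∷ []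
      ... | no ¬meet with any? (λ a → any? (λ b → edge? T b a) B) A
      ...   | yes edge with a , a∈A , toA ← find edge
                       with b , b∈B , ba ← find toA
                       with av , a∉C ← A⁻ a∈A | ub , b∉C ← B⁻ b∈B =
        b ∷ a ∷ [] , s≤s (s≤s z≤n) ,
        (λ { (here refl , b∈C) → b∉C b∈C ; (there (here refl) , a∈C) → a∉C a∈C }) ,
        ub ∷ ba ∷ av ∷ [-] ,
        (∈C⇒≢ u∈C b∉C ∷ ∈C⇒≢ u∈C a∉C ∷ u≢v ∷ []) ∷
        ((λ b≡a → loop-free T b≡a ba) ∷ ≢-sym (∈C⇒≢ v∈C b∉C) ∷ []) ∷
        (≢-sym (∈C⇒≢ v∈C a∉C) ∷ []) ∷ [] ∷ []
      -- Since `A` and `B` do not meet, `a` and `b` are distinct, and the absence of the edge from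
      -- `b` to `a` forces the opposite one.
      ...   | no ¬edge = contradiction
        (λ {a} {b} a∈A b∈B → reverseEdge
          (λ b≡a → ¬meet (lose a∈A (subst (_∈ B) b≡a b∈B)))
          (λ ba → ¬edge (lose a∈A (lose b∈B ba))))
        (notDominating (λ (x∈A , x∈B) → ¬meet (lose x∈A x∈B)))

    -- Assembling the subdivision

    -- The constant `c` allows two interior vertices for each of the `k * k` pairs, diagonal ones
    -- included, plus the `k` branch vertices. The vertex `u₀` serves to show that `T` has at least
    -- `k` vertices.
    completeSubdivision : ∀ k → let c = k * k * 2 + k in
      Fin n → (∀ u → 2 ^ suc c + c ≤ length (N⁺ u)) → Subdivision (completeDigraph k) T
    completeSubdivision k u₀ large with topElements (length ∘ N⁻) k k≤n
      where
      open ≤-Reasoning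
      c = k * k * 2 + k

      k≤n : k ≤ n
      k≤n = begin
        k                     ≤⟨ m≤n+m k (k * k * 2) ⟩
        c                     ≤⟨ m≤n+m c (2 ^ suc c) ⟩
        2 ^ suc c + c         ≤⟨ large u₀ ⟩
        length (N⁺ u₀)        ≤⟨ length-filter (edge? T u₀) (allFin n) ⟩
        length (allFin n)     ≡⟨ length-tabulate {n = n} id ⟩
        n                     ∎
    ... | S , uS , refl , top with chooseDisjoint (k * k) (uncurry Good ∘ remQuot k)
                                     (λ i → uncurry choose (remQuot k i)) [] (≤-reflexive (+-identityʳ (k * k * 2)))
      where
      -- Coding pairs by `Fin (k * k)` includes the diagonal, where the second condition is void and
      -- the empty list will do.
      Good : Fin k → Fin k → List (Fin n) → Set
      Good i j xs = Disjoint xs S × (i ≢ j → IsInterior xs (lookup S i) (lookup S j))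

      choose : ∀ i j C → length C ≤ k * k * 2 → ∃[ xs ] (length xs ≤ 2 × Disjoint xs C × Good i j xs)
      choose i j C C≤ with i ≟ j
      ... | yes i≡j = [] , z≤n , (λ ()) , (λ ()) , λ i≢j → contradiction i≡j i≢j
      -- `C` holds the interiors chosen so far; appending `S` adds the branch vertices, among them
      -- both ends of the new path.
      ... | no  i≢j with shortPathAvoiding (C ++ S)
                           (≤-trans (≤-reflexive (length-++ C)) (+-monoˡ-≤ k C≤))
                           (∈-++⁺ʳ C (∈-lookup i)) (∈-++⁺ʳ C (∈-lookup j))
                           (i≢j ∘ lookup-injective uS)
                           (λ b∉ → top (b∉ ∘ ∈-++⁺ʳ C) (∈-lookup j))
                           (large (lookup S i))
      ...   | xs , xs≤2 , xs#CS , interior =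
        xs , xs≤2 , (λ (p , q) → xs#CS (p , ∈-++⁺ˡ q)) ,
        (λ (p , q) → xs#CS (p , ∈-++⁺ʳ C q)) , λ _ → interior
    ... | f , good , _ , f#f = record
      { branch           = lookup S
      ; branch-injective = lookup-injective uS
      ; path             = λ {i} {j} i≢j → record
        { interior = f (combine i j)
        ; linked   = proj₁ (proj₂ (good′ i j) i≢j)
        ; unique   = proj₂ (proj₂ (good′ i j) i≢j)
        }
      ; avoids-branch    = λ {i} {j} _ x∈ l x≡ → avoids i j l (subst (_∈ f (combine i j)) x≡ x∈)
      ; disjoint         = λ {i} {j} {i′} {j′} _ _ → disjoint′ i j i′ j′
      }
      where
      good′ : ∀ i j → Disjoint (f (combine i j)) S ×
              (i ≢ j → IsInterior (f (combine i j)) (lookup S i) (lookup S j))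
      -- Decoding `combine i j` returns `(i , j)` only up to a propositional equality; the list is
      -- held fixed during the transport.
      good′ i j = subst (λ (i , j) → Disjoint xs S × (i ≢ j → IsInterior xs (lookup S i) (lookup S j)))
                        (remQuot-combine i j) (good (combine i j))
        where xs = f (combine i j)

      avoids : ∀ i j l → lookup S l ∉ f (combine i j)
      avoids i j l l∈ = proj₁ (good′ i j) (l∈ , ∈-lookup l)

      disjoint′ : ∀ i j i′ j′ → (i , j) ≢ (i′ , j′) → ∀ {x} → x ∈ f (combine i j) →
                  x ∉ lookup S i′ ∷ f (combine i′ j′) ++ lookup S j′ ∷ []
      disjoint′ i j i′ j′ ≢ x∈ (here refl) = avoids i j i′ x∈
      disjoint′ i j i′ j′ ≢ x∈ (there x∈′) with ∈-++⁻ (f (combine i′ j′)) x∈′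
      ... | inj₁ x∈f         = f#f (λ eq → ≢ (injective eq)) (x∈ , x∈f)
        where
        injective : combine i j ≡ combine i′ j′ → (i , j) ≡ (i′ , j′)
        injective eq with refl , refl ← combine-injective i j i′ j′ eq = refl
      ... | inj₂ (here refl) = avoids i j j′ x∈

theorem1p2 : ∀ (k : ℕ) → 0 < k → ∃[ d ] (0 < d × (∀ (n : ℕ) (T : Digraph (suc n)) → IsTournament T → δ⁺ T ≥ d → Subdivision (completeDigraph k) T))
theorem1p2 k _ = d , ≤-trans (m^n>0 2 (suc c)) (m≤m+n (2 ^ suc c) c) , λ n T tournament δ≥d →
  -- The vertex set is nonempty, so `zero` can serve as `u₀`.
  completeSubdivision T tournament k zero λ u →
    ≤-trans δ≥d (≤-trans (foldr₁-⊓-≤ (outDegree T) u) (≤-reflexive (count-tabulate (edge? T u) id)))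
  where
  c = k * k * 2 + k
  d = 2 ^ suc c + c
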